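{- Let $n\ge 3$ be an integer and let $L(K_n)$ be the line graph of the complete graph $K_n$ on $n$ vertices. Then \[ \mathrm{gp}(L(K_n))=\begin{cases} n, & 3\mid n,\\ n-1, & 3\nmid n. \end{cases} \]
   Context: Graphs are finite, undirected and simple. The line graph $L(G)$ of a graph $G$ has vertex set $E(G)$, two different vertices of $L(G)$ being adjacent if the corresponding edges share a vertex in $G$. For a graph $G$, $d_G$ is the shortest-path distance; a $u,v$-geodesic is a $u,v$-path of length $d_G(u,v)$. A set $S\subseteq V(G)$ is a general position set of $G$ if no vertex of $S$ lies on a geodesic between two other vertices of $S$. The general position number $\mathrm{gp}(G)$ is the maximum cardinality of a general position set of $G$. -}

module Defs where

import Data.Fin.Properties as Fin
open import Data.List using (List; []; _∷_; length; mapMaybe; cartesianProduct; allFin)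
open import Data.List.Membership.Propositional.Properties using (∈-allFin)
import Data.List.Membership.Setoid as Membership
open import Data.List.Relation.Unary.Any as Any using (Any)
import Data.List.Relation.Unary.Any.Properties as Any
import Data.List.Relation.Unary.Enumerates.Setoid as Enumerates
import Data.List.Relation.Unary.Unique.Setoid as Uniqueness
open import Data.Maybe using (Maybe; just; nothing)
import Data.Maybe.Relation.Unary.Any as Maybe
open import Data.Nat using (ℕ; zero; suc; _≤_)
open import Data.Product using (∃-syntax; _×_; _,_; proj₁; proj₂)
open import Data.Sum using (_⊎_; inj₁; inj₂)
open import Level using (0ℓ)
open import Relation.Binary
  using (Rel; DecSetoid; Decidable; Symmetric; Transitive; Irreflexive; _Respects₂_)
open import Relation.Binary.PropositionalEquality
  using (_≡_; _≢_; ≢-sym; resp₂)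
open import Relation.Nullary using (Dec; yes; no; ¬_; contradiction)
open import Relation.Nullary.Decidable using (map′; _×-dec_; _⊎-dec_; ¬?)

-- Vertices form a setoid, so that the vertices of a line graph can be
-- unordered pairs. All counting below is up to its equality _≈_.
-- The list `vertices` witnesses finiteness; it may contain repetitions.
record Graph : Set₁ where
  infix 4 _~_ _~?_
  field
    vertexSetoid : DecSetoid 0ℓ 0ℓ

  open DecSetoid vertexSetoid public
    using (_≈_; _≉_; _≟_; setoid)
    renaming (Carrier to V; refl to ≈-refl; sym to ≈-sym; trans to ≈-trans)
  open Membership setoid public using (_∈_; _∉_)
  open Uniqueness setoid public using (Unique)
  open Enumerates setoid public using (IsEnumeration)

  field
    _~_        : Rel V 0ℓ
    _~?_       : Decidable _~_
    ~-resp-≈   : _~_ Respects₂ _≈_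
    ~-sym      : Symmetric _~_
    ~-irrefl   : Irreflexive _≈_ _~_
    vertices   : List V
    enumerates : IsEnumeration vertices

------------------------------------------------------------------------
-- Paths, distance and general position

module _ (G : Graph) where
  open Graph G

  data Walk : V → V → Set where
    stop : ∀ {u v} → u ≈ v → Walk u v
    step : ∀ {u v w} → u ~ v → Walk v w → Walk u w

module _ {G : Graph} where
  open Graph G

  walkLength : ∀ {u v} → Walk G u v → ℕ
  walkLength (stop _)   = zero
  walkLength (step _ p) = suc (walkLength p)

  walkVertices : ∀ {u v} → Walk G u v → List V
  walkVertices (stop {u} _)   = u ∷ []
  walkVertices (step {u} _ p) = u ∷ walkVertices p

  IsPath : ∀ {u v} → Walk G u v → Set
  IsPath p = Unique (walkVertices p)

module _ (G : Graph) where
  open Graph G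

  -- The graph of the partial function d_G, which is undefined (infinite)
  -- between different components.
  IsDistance : V → V → ℕ → Set
  IsDistance u v d =
    (∃[ p ] IsPath {G} {u} {v} p × walkLength p ≡ d) ×
    (∀ (p : Walk G u v) → IsPath p → d ≤ walkLength p)

  IsGeodesic : ∀ {u v} → Walk G u v → Set
  IsGeodesic {u} {v} p = IsPath p × IsDistance u v (walkLength p)

  -- A set of vertices is a list without repetitions.
  record IsGeneralPositionSet (S : List V) : Set where
    field
      unique : Unique S
      noneBetween : ∀ {x y z} → x ∈ S → y ∈ S → z ∈ S →
        x ≉ y → x ≉ z → y ≉ z →
        ∀ (p : Walk G y z) → IsGeodesic p → x ∉ walkVertices p

  -- gp(G) = k, that is, k is the maximum size of a general position set.
  record IsGpNumber (k : ℕ) : Set where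
    field
      attained : ∃[ S ] IsGeneralPositionSet S × length S ≡ k
      bounded  : ∀ S → IsGeneralPositionSet S → length S ≤ k

------------------------------------------------------------------------
-- Complete graphs

completeGraph : ℕ → Graph
completeGraph n = record
  { vertexSetoid = Fin.≡-decSetoid n
  ; _~_          = _≢_
  ; _~?_         = λ i j → ¬? (i Fin.≟ j)
  ; ~-resp-≈     = resp₂ _≢_
  ; ~-sym        = ≢-sym
  ; ~-irrefl     = λ i≡j i≢j → i≢j i≡j
  ; vertices     = allFin n
  ; enumerates   = ∈-allFin
  }

------------------------------------------------------------------------
-- Line graphs

module _ (G : Graph) where
  open Graph G

  record Edge : Set where
    constructor edge
    field
      end₁ end₂ : V
      adjacent  : end₁ ~ end₂

module _ {G : Graph} where
  open Graph G
  open Edge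

  infix 4 _≈ₑ_ _≈ₑ?_ _on_ _on?_ _~ₑ_ _~ₑ?_

  -- Equality of edges as unordered pairs.
  _≈ₑ_ : Rel (Edge G) 0ℓ
  e ≈ₑ f = (end₁ e ≈ end₁ f × end₂ e ≈ end₂ f)
         ⊎ (end₁ e ≈ end₂ f × end₂ e ≈ end₁ f)

  _≈ₑ?_ : Decidable _≈ₑ_
  e ≈ₑ? f = ((end₁ e ≟ end₁ f) ×-dec (end₂ e ≟ end₂ f))
     ⊎-dec ((end₁ e ≟ end₂ f) ×-dec (end₂ e ≟ end₁ f))

  ≈ₑ-sym : Symmetric _≈ₑ_
  ≈ₑ-sym (inj₁ (p , q)) = inj₁ (≈-sym p , ≈-sym q)
  ≈ₑ-sym (inj₂ (p , q)) = inj₂ (≈-sym q , ≈-sym p)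

  ≈ₑ-trans : Transitive _≈ₑ_
  ≈ₑ-trans (inj₁ (p , q)) (inj₁ (r , s)) = inj₁ (≈-trans p r , ≈-trans q s)
  ≈ₑ-trans (inj₁ (p , q)) (inj₂ (r , s)) = inj₂ (≈-trans p r , ≈-trans q s)
  ≈ₑ-trans (inj₂ (p , q)) (inj₁ (r , s)) = inj₂ (≈-trans p s , ≈-trans q r)
  ≈ₑ-trans (inj₂ (p , q)) (inj₂ (r , s)) = inj₁ (≈-trans p s , ≈-trans q r)

  _on_ : V → Edge G → Set
  v on e = v ≈ end₁ e ⊎ v ≈ end₂ e

  on-resp : ∀ {v e f} → e ≈ₑ f → v on e → v on f
  on-resp (inj₁ (p , q)) (inj₁ r) = inj₁ (≈-trans r p)
  on-resp (inj₁ (p , q)) (inj₂ r) = inj₂ (≈-trans r q)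
  on-resp (inj₂ (p , q)) (inj₁ r) = inj₂ (≈-trans r p)
  on-resp (inj₂ (p , q)) (inj₂ r) = inj₁ (≈-trans r q)

  on-≈ : ∀ {u v} (e : Edge G) → u ≈ v → v on e → u on e
  on-≈ e u≈v (inj₁ p) = inj₁ (≈-trans u≈v p)
  on-≈ e u≈v (inj₂ p) = inj₂ (≈-trans u≈v p)

  _on?_ : ∀ v (e : Edge G) → Dec (v on e)
  v on? e = (v ≟ end₁ e) ⊎-dec (v ≟ end₂ e)

  _~ₑ_ : Rel (Edge G) 0ℓ
  e ~ₑ f = ¬ (e ≈ₑ f) × ∃[ v ] v on e × v on f

  _~ₑ?_ : Decidable _~ₑ_
  e ~ₑ? f = ¬? (e ≈ₑ? f) ×-dec
            map′ from to ((end₁ e on? f) ⊎-dec (end₂ e on? f))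
    where
    from : end₁ e on f ⊎ end₂ e on f → ∃[ v ] v on e × v on f
    from (inj₁ p) = end₁ e , inj₁ ≈-refl , p
    from (inj₂ p) = end₂ e , inj₂ ≈-refl , p

    to : ∃[ v ] v on e × v on f → end₁ e on f ⊎ end₂ e on f
    to (v , inj₁ p , q) = inj₁ (on-≈ f (≈-sym p) q)
    to (v , inj₂ p , q) = inj₂ (on-≈ f (≈-sym p) q)

  ~ₑ-sym : Symmetric _~ₑ_
  ~ₑ-sym {e} {f} (e≉f , v , p , q) = (λ f≈e → e≉f (≈ₑ-sym {f} {e} f≈e)) , v , q , p

  ~ₑ-resp-≈ₑ : _~ₑ_ Respects₂ _≈ₑ_
  ~ₑ-resp-≈ₑ = (λ {e} {f} {g} → respʳ e f g) ,
               (λ {e} {f} {g} f≈g f~e → ~ₑ-sym {e} {g} (respʳ e f g f≈g (~ₑ-sym {f} {e} f~e)))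
    where
    respʳ : ∀ e f g → f ≈ₑ g → e ~ₑ f → e ~ₑ g
    respʳ e f g f≈g (e≉f , v , p , q) =
      (λ e≈g → e≉f (≈ₑ-trans {e} {g} {f} e≈g (≈ₑ-sym {f} {g} f≈g))) ,
      v , p , on-resp {v} {f} {g} f≈g q

  edgeBetween : V × V → Maybe (Edge G)
  edgeBetween (u , v) with u ~? v
  ... | yes u~v = just (edge u v u~v)
  ... | no  _   = nothing

  edges : List (Edge G)
  edges = mapMaybe edgeBetween (cartesianProduct vertices vertices)

  edges-complete : ∀ e → Any (e ≈ₑ_) edges
  edges-complete e = Any.mapMaybe⁺ edgeBetween (cartesianProduct vertices vertices)
    (Any.map⁺ (Any.map found
      (Any.cartesianProduct⁺ (enumerates (end₁ e)) (enumerates (end₂ e)))))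
    where
    found : ∀ {uv} → end₁ e ≈ proj₁ uv × end₂ e ≈ proj₂ uv →
            Maybe.Any (e ≈ₑ_) (edgeBetween uv)
    found {u , v} (p , q) with u ~? v
    ... | yes u~v = Maybe.just (inj₁ (p , q))
    ... | no  u≁v = contradiction
            (proj₁ ~-resp-≈ q (proj₂ ~-resp-≈ p (adjacent e))) u≁v

lineGraph : Graph → Graph
lineGraph G = record
  { vertexSetoid = record
    { Carrier = Edge G
    ; _≈_     = _≈ₑ_
    ; isDecEquivalence = record
      { isEquivalence = record
        { refl  = inj₁ (≈-refl , ≈-refl)
        ; sym   = λ {e} {f} → ≈ₑ-sym {G} {e} {f}
        ; trans = λ {e} {f} {g} → ≈ₑ-trans {G} {e} {f} {g}
        }
      ; _≟_ = _≈ₑ?_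
      }
    }
  ; _~_        = _~ₑ_
  ; _~?_       = _~ₑ?_
  ; ~-resp-≈   = ~ₑ-resp-≈ₑ
  ; ~-sym      = λ {e} {f} → ~ₑ-sym {G} {e} {f}
  ; ~-irrefl   = λ e≈f e~f → proj₁ e~f e≈f
  ; vertices   = edges
  ; enumerates = edges-complete
  }
  where open Graph G

{-# OPTIONS --safe #-}
module Submission where

-- L(Kₙ) has diameter at most 2, so a set of vertices is in general position exactly when it
-- induces a disjoint union of cliques. A clique of L(Kₙ) is a star or a triangle of Kₙ; hence a
-- general position set is a set of edges whose components in Kₙ are stars and triangles.
-- A triangle has as many edges as vertices and a star has one edge fewer, so there are at most
-- n edges, and n only if triangles cover all the vertices. The bound is reached by n / 3 disjoint
-- triangles if 3 ∣ n, and by a spanning star otherwise.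

open import Defs
open import Data.Fin using (Fin; zero; suc; combine; remQuot)
import Data.Fin.Properties as Fin
open import Data.List using (List; []; _∷_; _++_; length; tabulate; allFin)
open import Data.List.Membership.Propositional using (_∈_; find)
open import Data.List.Membership.Propositional.Properties using (∈-∃++; ∈-allFin)
import Data.List.Membership.Setoid.Properties as Membershipₛ
open import Data.List.Properties using (length-tabulate)
open import Data.List.Relation.Binary.Permutation.Propositional
  using (_↭_; ↭-refl; ↭-sym; ↭-trans; ↭-prep; ↭⇒↭ₛ)
open import Data.List.Relation.Binary.Permutation.Propositional.Properties
  using (∈-resp-↭; ↭-length; shift)
import Data.List.Relation.Binary.Permutation.Setoid.Properties as Permutationₛ
open import Data.List.Relation.Unary.All as All using ([]; _∷_)
open import Data.List.Relation.Unary.AllPairs using ([]; _∷_)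
open import Data.List.Relation.Unary.Any as Any using (Any; here; there; any?)
import Data.List.Relation.Unary.Unique.Setoid.Properties as Uniqueₛ
open import Data.Nat using (ℕ; zero; suc; _+_; _*_; _∸_; _≤_; _<_; z≤n; s≤s; z<s; s<s)
open import Data.Nat.Divisibility using (_∣_; _∤_; divides; _∣0; ∣-refl; ∣m∣n⇒∣m+n)
open import Data.Nat.Induction using (Acc; acc; <-wellFounded)
import Data.Nat.Properties as ℕ
open import Data.Product using (∃-syntax; _×_; _,_; proj₁; proj₂)
open import Data.Sum using (_⊎_; inj₁; inj₂; [_,_]′)
open import Function using (_∘_; id)
open import Level using (0ℓ)
open import Relation.Binary.PropositionalEquality
  using (_≡_; _≢_; refl; sym; trans; cong; subst; ≢-sym; resp₂; setoid; module ≡-Reasoning)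
open import Relation.Nullary using (yes; no; ¬_; contradiction)
open import Relation.Unary using (Pred)

-- Cluster sets and general position.

module _ (G : Graph) where
  open Graph G renaming (_∈_ to _∈ᴳ_)

  -- P induces no path on three vertices, i.e. a disjoint union of cliques.
  IsClusterSet : Pred V 0ℓ → Set
  IsClusterSet P = ∀ {x y z} → P x → P y → P z → y ≉ z → x ~ y → x ~ z → y ~ z

  ~⇒≉ : ∀ {x y} → x ~ y → x ≉ y
  ~⇒≉ x~y x≈y = ~-irrefl x≈y x~y

  nonadjacent⇒2≤walkLength : ∀ {y z} → y ≉ z → ¬ y ~ z → (p : Walk G y z) → 2 ≤ walkLength p
  nonadjacent⇒2≤walkLength y≉z y≁z (stop y≈z)            = contradiction y≈z y≉z
  nonadjacent⇒2≤walkLength y≉z y≁z (step y~v (stop v≈z)) = contradiction (proj₁ ~-resp-≈ v≈z y~v) y≁z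
  nonadjacent⇒2≤walkLength y≉z y≁z (step _ (step _ p))   = s≤s (s≤s z≤n)

  edgeWalk : ∀ {y z} → y ~ z → Walk G y z
  edgeWalk y~z = step y~z (stop ≈-refl)

  edgeWalk-isPath : ∀ {y z} (y~z : y ~ z) → IsPath (edgeWalk y~z)
  edgeWalk-isPath y~z = (~⇒≉ y~z ∷ []) ∷ [] ∷ []

  twoStepWalk : ∀ {y x z} → y ~ x → x ~ z → Walk G y z
  twoStepWalk y~x x~z = step y~x (edgeWalk x~z)

  twoStepWalk-isPath : ∀ {y x z} → y ≉ z → (y~x : y ~ x) (x~z : x ~ z) →
                       IsPath (twoStepWalk y~x x~z)
  twoStepWalk-isPath y≉z y~x x~z = (~⇒≉ y~x ∷ y≉z ∷ []) ∷ edgeWalk-isPath x~z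

  -- Two distinct nonadjacent neighbours `y`, `z` of `x` are at distance two, so the walk through
  -- `x` is a geodesic, which general position forbids.
  generalPosition⇒cluster : ∀ {S} → IsGeneralPositionSet G S → IsClusterSet (_∈ᴳ S)
  generalPosition⇒cluster gp {x} {y} {z} x∈S y∈S z∈S y≉z x~y x~z with y ~? z
  ... | yes y~z = y~z
  ... | no  y≁z = contradiction (there (here ≈-refl))
    (noneBetween x∈S y∈S z∈S (~⇒≉ x~y) (~⇒≉ x~z) y≉z p (p-isPath , (p , p-isPath , refl) , λ q _ →
      nonadjacent⇒2≤walkLength y≉z y≁z q))
    where
    open IsGeneralPositionSet gp
    p = twoStepWalk (~-sym x~y) x~z
    p-isPath = twoStepWalk-isPath y≉z (~-sym x~y) x~z

  -- By `diam≤2` a geodesic has at most two steps, so a third point `x` of `S` could only be the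
  -- middle of a two-step one. Then `cluster` makes the ends adjacent, and the walk was not
  -- shortest.
  cluster⇒generalPosition : (∀ {y z} → y ≉ z → ¬ y ~ z → ∃[ x ] y ~ x × x ~ z) →
    ∀ {S} → Unique S → IsClusterSet (_∈ᴳ S) → IsGeneralPositionSet G S
  cluster⇒generalPosition diam≤2 {S} unique cluster = record
    { unique = unique ; noneBetween = none }
    where
    none : ∀ {x y z} → x ∈ᴳ S → y ∈ᴳ S → z ∈ᴳ S → x ≉ y → x ≉ z → y ≉ z →
           ∀ (p : Walk G y z) → IsGeodesic G p → ¬ x ∈ᴳ walkVertices p
    none _ _ _ x≉y x≉z y≉z (stop y≈z) _ _ = y≉z y≈z
    none _ _ _ x≉y x≉z y≉z (step _ (stop v≈z)) _ (here x≈y) = x≉y x≈y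
    none _ _ _ x≉y x≉z y≉z (step _ (stop v≈z)) _ (there (here x≈v)) = x≉z (≈-trans x≈v v≈z)
    none _ _ _ x≉y x≉z y≉z (step _ (step _ (stop w≈z))) _ (here x≈y) = x≉y x≈y
    none _ _ _ x≉y x≉z y≉z (step _ (step _ (stop w≈z))) _ (there (there (here x≈w))) =
      x≉z (≈-trans x≈w w≈z)
    none x∈S y∈S z∈S x≉y x≉z y≉z (step y~v (step v~w (stop w≈z))) (_ , _ , minimal)
      (there (here x≈v)) =
      contradiction (minimal (edgeWalk y~z) (edgeWalk-isPath y~z)) λ { (s≤s ()) }
      where
      y~z = cluster x∈S y∈S z∈S y≉z
        (~-sym (proj₁ ~-resp-≈ (≈-sym x≈v) y~v))
        (proj₁ ~-resp-≈ w≈z (proj₂ ~-resp-≈ (≈-sym x≈v) v~w))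
    none {y = y} {z} _ _ _ x≉y x≉z y≉z (step _ (step _ (step _ p))) (_ , _ , minimal) _ with y ~? z
    ... | yes y~z = contradiction (minimal (edgeWalk y~z) (edgeWalk-isPath y~z)) λ { (s≤s ()) }
    ... | no  y≁z with _ , y~x , x~z ← diam≤2 y≉z y≁z =
      contradiction (minimal (twoStepWalk y~x x~z) (twoStepWalk-isPath y≉z y~x x~z)) λ { (s≤s (s≤s ())) }

∈⇒∃↭ : ∀ {A : Set} {x : A} {xs} → x ∈ xs → ∃[ ys ] xs ↭ x ∷ ys
∈⇒∃↭ x∈xs with ys , zs , refl ← ∈-∃++ x∈xs = ys ++ zs , shift _ ys zs

∈-drop : ∀ {A : Set} {x y : A} {xs ys} → xs ↭ y ∷ ys → x ≢ y → x ∈ xs → x ∈ ys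
∈-drop xs↭y∷ys x≢y x∈xs with ∈-resp-↭ xs↭y∷ys x∈xs
... | here x≡y   = contradiction x≡y x≢y
... | there x∈ys = x∈ys

-- Edges of the complete graph and their ends.

module _ {n : ℕ} where

  L : Graph
  L = lineGraph (completeGraph n)

  open Graph L renaming (V to E; _∈_ to _∈ᴸ_; setoid to setoidᴸ)
  open Edge

  infix 4 _∋_
  _∋_ : E → Fin n → Set
  e ∋ v = v on e

  -- Names the two ends in either order, so that later arguments need not distinguish `end₁` from
  -- `end₂`.
  record Joins (a b : Fin n) (e : E) : Set where
    constructor joins
    field
      distinct : a ≢ b
      on₁      : e ∋ a
      on₂      : e ∋ b

  open Joins

  Joins-sym : ∀ {a b e} → Joins a b e → Joins b a e
  Joins-sym (joins a≢b a∈e b∈e) = joins (≢-sym a≢b) b∈e a∈e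

  Joins-ends : ∀ e → Joins (end₁ e) (end₂ e) e
  Joins-ends e = joins (adjacent e) (inj₁ refl) (inj₂ refl)

  Joins⇒end : ∀ {a b v} e → Joins a b e → e ∋ v → v ≡ a ⊎ v ≡ b
  Joins⇒end e (joins a≢b (inj₁ p) (inj₁ q)) _        = contradiction (trans p (sym q)) a≢b
  Joins⇒end e (joins a≢b (inj₂ p) (inj₂ q)) _        = contradiction (trans p (sym q)) a≢b
  Joins⇒end e (joins a≢b (inj₁ p) (inj₂ q)) (inj₁ r) = inj₁ (trans r (sym p))
  Joins⇒end e (joins a≢b (inj₁ p) (inj₂ q)) (inj₂ r) = inj₂ (trans r (sym q))
  Joins⇒end e (joins a≢b (inj₂ p) (inj₁ q)) (inj₁ r) = inj₂ (trans r (sym q))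
  Joins⇒end e (joins a≢b (inj₂ p) (inj₁ q)) (inj₂ r) = inj₁ (trans r (sym p))

  Joins-unique : ∀ {a b} e f → Joins a b e → Joins a b f → e ≈ f
  Joins-unique e f ab@(joins a≢b a∈e b∈e) ab′
    with Joins⇒end f ab′ (inj₁ refl) | Joins⇒end f ab′ (inj₂ refl)
       | Joins⇒end e ab (inj₁ refl) | Joins⇒end e ab (inj₂ refl)
  ... | inj₁ p | inj₁ q | _      | _      = contradiction (trans p (sym q)) (adjacent f)
  ... | inj₂ p | inj₂ q | _      | _      = contradiction (trans p (sym q)) (adjacent f)
  ... | _      | _      | inj₁ r | inj₁ s = contradiction (trans r (sym s)) (adjacent e)
  ... | _      | _      | inj₂ r | inj₂ s = contradiction (trans r (sym s)) (adjacent e)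
  ... | inj₁ p | inj₂ q | inj₁ r | inj₂ s = inj₁ (trans r (sym p) , trans s (sym q))
  ... | inj₁ p | inj₂ q | inj₂ r | inj₁ s = inj₂ (trans r (sym q) , trans s (sym p))
  ... | inj₂ p | inj₁ q | inj₁ r | inj₂ s = inj₂ (trans r (sym q) , trans s (sym p))
  ... | inj₂ p | inj₁ q | inj₂ r | inj₁ s = inj₁ (trans r (sym p) , trans s (sym q))

  -- If `h` contained `a`, then `h` and `g` would both be adjacent to `e`, hence to each other. They
  -- would meet in `b` or in `c`, making `h` equal to `e` or to `f`.
  triangle-closed : ∀ {P a b c} e f g → IsClusterSet L P →
    P e → P g → Joins a b e → Joins a c f → Joins b c g → e ≉ g →
    ∀ h → P h → h ≉ e → h ≉ f → h ≉ g → ¬ h ∋ a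
  triangle-closed {a = a} {b} e f g cluster Pe Pg ab ac bc e≉g h Ph h≉e h≉f h≉g a∈h
    with _ , v , v∈h , v∈g ← cluster {e} {h} {g} Pe Ph Pg h≉g
           (h≉e ∘ ≈-sym {e} {h} , a , on₁ ab , a∈h) (e≉g , b , on₂ ab , on₁ bc)
    with Joins⇒end g bc v∈g
  ... | inj₁ refl = h≉e (Joins-unique h e (joins (distinct ab) a∈h v∈h) ab)
  ... | inj₂ refl = h≉f (Joins-unique h f (joins (distinct ac) a∈h v∈h) ac)

  -- Bounding the number of edges of a cluster set.

  -- Membership is propositional, so that edges can be extracted up to permutation, while `Unique`
  -- compares edges as unordered pairs. `U` is any list containing all the ends; the induction
  -- deletes vertices from it along with edges from `S`.
  record IsClusterOn (S : List E) (U : List (Fin n)) : Set where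
    field
      unique  : Unique S
      cluster : IsClusterSet L (_∈ S)
      ends    : ∀ {e v} → e ∈ S → e ∋ v → v ∈ U

  open IsClusterOn

  head≉ : ∀ {e S U f} → IsClusterOn (e ∷ S) U → f ∈ S → e ≉ f
  head≉ c f∈S with e≉S ∷ _ ← unique c = All.lookup e≉S f∈S

  IsClusterOn-resp-↭ : ∀ {S S′ U} → S ↭ S′ → IsClusterOn S U → IsClusterOn S′ U
  IsClusterOn-resp-↭ S↭S′ c = record
    { unique  = Permutationₛ.AllPairs-resp-↭ (setoid E)
        (λ {e} {f} e≉f f≈e → e≉f (≈-sym {f} {e} f≈e)) (resp₂ _≉_) (↭⇒↭ₛ S↭S′) (unique c)
    ; cluster = λ x∈ y∈ z∈ → cluster c (back x∈) (back y∈) (back z∈)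
    ; ends    = λ e∈ → ends c (back e∈)
    }
    where
    back : ∀ {e} → e ∈ _ → e ∈ _
    back = ∈-resp-↭ (↭-sym S↭S′)

  IsClusterOn-tail : ∀ {e S U U′} → IsClusterOn (e ∷ S) U →
    (∀ {f v} → f ∈ S → f ∋ v → v ∈ U → v ∈ U′) → IsClusterOn S U′
  IsClusterOn-tail c ends′ with _ ∷ uniqueS ← unique c = record
    { unique  = uniqueS
    ; cluster = λ x∈ y∈ z∈ → cluster c (there x∈) (there y∈) (there z∈)
    ; ends    = λ f∈ v∈f → ends′ f∈ v∈f (ends c (there f∈) v∈f)
    }

  StartsPath₂ : List E → Fin n → Set
  StartsPath₂ S v = ∃[ f ] ∃[ g ] f ∈ S × g ∈ S × f ∋ v × f ~ g × ¬ g ∋ v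

  -- In a cluster set a neighbour of a leaf is the centre of a star and so starts no path with
  -- two edges; the last field of tight therefore rules out equality when a leaf is put back.
  data SizeBound (S : List E) (U : List (Fin n)) : Set where
    fewer : length S < length U → SizeBound S U
    tight : length S ≡ length U → 3 ∣ length U → (∀ {v} → v ∈ U → StartsPath₂ S v) →
            SizeBound S U

  SizeBound-resp-↭ : ∀ {S S′ U U′} → S ↭ S′ → U ↭ U′ → SizeBound S U → SizeBound S′ U′
  SizeBound-resp-↭ S↭S′ U↭U′ (fewer S<U) =
    fewer (subst (_< _) (↭-length S↭S′) (subst (_ <_) (↭-length U↭U′) S<U))
  SizeBound-resp-↭ S↭S′ U↭U′ (tight S≡U 3∣U paths) =
    tight (trans (sym (↭-length S↭S′)) (trans S≡U (↭-length U↭U′)))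
          (subst (3 ∣_) (↭-length U↭U′) 3∣U)
          λ v∈U′ → let f , g , f∈S , g∈S , rest = paths (∈-resp-↭ (↭-sym U↭U′) v∈U′)
                   in f , g , ∈-resp-↭ S↭S′ f∈S , ∈-resp-↭ S↭S′ g∈S , rest

  -- Deleting `e` together with its leaf `b` shortens both lists by one, so a strict inequality
  -- survives. Were the rest tight, a path `f`, `g` would start at `a`; then `e` and `g`, both
  -- adjacent to `f`, would have to meet, but `g` avoids `a` and no edge of `S` contains `b`.
  SizeBound-addLeaf : ∀ {a b e S U} → IsClusterOn (e ∷ S) U → Joins a b e →
    ¬ Any (_∋ b) S → (∀ {U′} → IsClusterOn S U′ → SizeBound S U′) → SizeBound (e ∷ S) U
  SizeBound-addLeaf {a} {b} {e} {S} {U} c ab b∉S bound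
    with U′ , U↭b∷U′ ← ∈⇒∃↭ (ends c (here refl) (on₂ ab))
    with bound {U′} (IsClusterOn-tail c
           λ {f} f∈S v∈f → ∈-drop U↭b∷U′ λ { refl → b∉S (Any.map (λ { refl → v∈f }) f∈S) })
  ... | fewer S<U′ = SizeBound-resp-↭ ↭-refl (↭-sym U↭b∷U′) (fewer (s<s S<U′))
  ... | tight _ _ paths
    with f , g , f∈S , g∈S , a∈f , f~g , a∉g ←
           paths (∈-drop U↭b∷U′ (distinct ab) (ends c (here refl) (on₁ ab)))
    with _ , v , v∈e , v∈g ← cluster c {f} {e} {g} (there f∈S) (here refl) (there g∈S)
           (head≉ c g∈S) (head≉ c f∈S ∘ ≈-sym {f} {e} , a , a∈f , on₁ ab) f~g
    with Joins⇒end e ab v∈e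
  ... | inj₁ refl = contradiction v∈g a∉g
  ... | inj₂ refl = contradiction (Any.map (λ { refl → v∈g }) g∈S) b∉S

  -- No other edge touches the triangle, so its three edges and three corners can be deleted
  -- together. Both lengths change by three, which preserves strictness, equality and divisibility
  -- by 3.
  SizeBound-addTriangle : ∀ {a b c e f g S U} → IsClusterOn (e ∷ f ∷ g ∷ S) U →
    Joins a b e → Joins a c f → Joins b c g →
    (∀ {U′} → IsClusterOn S U′ → SizeBound S U′) → SizeBound (e ∷ f ∷ g ∷ S) U
  SizeBound-addTriangle {a} {b} {c} {e} {f} {g} {S} {U} cl ab ac bc bound = result
    where
    P = _∈ (e ∷ f ∷ g ∷ S)
    clf : IsClusterOn (f ∷ g ∷ S) U
    clf = IsClusterOn-tail cl λ _ _ v∈U → v∈U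
    clg : IsClusterOn (g ∷ S) U
    clg = IsClusterOn-tail clf λ _ _ v∈U → v∈U
    e≉f = head≉ cl (here refl)
    e≉g = head≉ cl (there (here refl))
    f≉e = e≉f ∘ ≈-sym {f} {e}

    module _ {h} (h∈S : h ∈ S) where
      Ph : P h
      Ph = there (there (there h∈S))
      h≉e = head≉ cl (there (there h∈S)) ∘ ≈-sym {h} {e}
      h≉f = head≉ clf (there h∈S) ∘ ≈-sym {h} {f}
      h≉g = head≉ clg h∈S ∘ ≈-sym {h} {g}
      a∉h : ¬ h ∋ a
      a∉h = triangle-closed e f g (cluster cl) (here refl) (there (there (here refl)))
              ab ac bc e≉g h Ph h≉e h≉f h≉g
      -- The same closure argument, with the triangle relabelled to put `b`, and then `c`, in the
      -- role of `a`.
      b∉h : ¬ h ∋ b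
      b∉h = triangle-closed e g f (cluster cl) (here refl) (there (here refl))
              (Joins-sym ab) bc ac e≉f h Ph h≉e h≉g h≉f
      c∉h : ¬ h ∋ c
      c∉h = triangle-closed f g e (cluster cl) (there (here refl)) (here refl)
              (Joins-sym ac) (Joins-sym bc) ab f≉e h Ph h≉f h≉g h≉e

    U↭ : ∃[ U′ ] U ↭ a ∷ b ∷ c ∷ U′
    U↭ with U₁ , U↭a∷U₁ ← ∈⇒∃↭ (ends cl (here refl) (on₁ ab))
       with U₂ , U₁↭b∷U₂ ← ∈⇒∃↭ (∈-drop U↭a∷U₁ (≢-sym (distinct ab)) (ends cl (here refl) (on₂ ab)))
       with U₃ , U₂↭c∷U₃ ← ∈⇒∃↭ (∈-drop U₁↭b∷U₂ (≢-sym (distinct bc))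
              (∈-drop U↭a∷U₁ (≢-sym (distinct ac)) (ends cl (there (here refl)) (on₂ ac))))
       = U₃ , ↭-trans U↭a∷U₁ (↭-prep a (↭-trans U₁↭b∷U₂ (↭-prep b U₂↭c∷U₃)))

    U′ = proj₁ U↭

    avoids : ∀ {h v} → h ∈ S → h ∋ v → v ∈ U → v ∈ U′
    avoids h∈S v∈h v∈U with ∈-resp-↭ (proj₂ U↭) v∈U
    ... | here refl                 = contradiction v∈h (a∉h h∈S)
    ... | there (here refl)         = contradiction v∈h (b∉h h∈S)
    ... | there (there (here refl)) = contradiction v∈h (c∉h h∈S)
    ... | there (there (there v∈U′)) = v∈U′

    opposite : ∀ {u v w} k → Joins v w k → u ≢ v → u ≢ w → ¬ k ∋ u
    opposite k vw u≢v u≢w u∈k = [ u≢v , u≢w ]′ (Joins⇒end k vw u∈k)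

    result : SizeBound (e ∷ f ∷ g ∷ S) U
    result with bound (IsClusterOn-tail clg avoids)
    ... | fewer S<U′ = SizeBound-resp-↭ ↭-refl (↭-sym (proj₂ U↭)) (fewer (s<s (s<s (s<s S<U′))))
    ... | tight S≡U′ 3∣U′ paths = SizeBound-resp-↭ ↭-refl (↭-sym (proj₂ U↭))
      (tight (cong (3 +_) S≡U′) (∣m∣n⇒∣m+n ∣-refl 3∣U′) λ
        -- From each corner a path runs along a side at that corner and then along the opposite
        -- side.
        { (here refl) → e , g , here refl , there (there (here refl)) , on₁ ab ,
            (e≉g , b , on₂ ab , on₁ bc) , opposite g bc (distinct ab) (distinct ac)
        ; (there (here refl)) → e , f , here refl , there (here refl) , on₂ ab ,
            (e≉f , a , on₁ ab , on₁ ac) , opposite f ac (≢-sym (distinct ab)) (distinct bc)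
        ; (there (there (here refl))) → f , e , there (here refl) , here refl , on₂ ac ,
            (f≉e , a , on₁ ac , on₁ ab) ,
            opposite e ab (≢-sym (distinct ac)) (≢-sym (distinct bc))
        ; (there (there (there v∈U′))) →
            let h , k , h∈S , k∈S , rest = paths v∈U′
            in h , k , there (there (there h∈S)) , there (there (there k∈S)) , rest
        })

  -- If some end of the first edge lies on no other edge, it is a leaf. Otherwise the edge belongs
  -- to a triangle. The recursion is well-founded on the length because a triangle removes three
  -- edges at once.
  sizeBound : ∀ S {U} → Acc _<_ (length S) → IsClusterOn S U → SizeBound S U
  -- With no edges and no vertices, equality holds with zero triangles and the path condition is
  -- vacuous.
  sizeBound [] {[]}    _ _ = tight refl (3 ∣0) λ ()
  sizeBound [] {_ ∷ _} _ _ = fewer z<s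
  sizeBound (e ∷ S) (acc rs) c with any? (end₂ e on?_) S | any? (end₁ e on?_) S
  ... | no b∉S | _ = SizeBound-addLeaf c (Joins-ends e) b∉S (sizeBound S (rs ℕ.≤-refl))
  ... | yes _ | no a∉S =
    SizeBound-addLeaf c (Joins-sym (Joins-ends e)) a∉S (sizeBound S (rs ℕ.≤-refl))
  ... | yes b∈S | yes a∈S
    with f , f∈S , a∈f ← find a∈S | g , g∈S , b∈g ← find b∈S = two-sided
    where
    a = end₁ e
    b = end₂ e
    e≉f = head≉ c f∈S
    e≉g = head≉ c g∈S

    b∉f : ¬ f ∋ b
    b∉f b∈f = e≉f (Joins-unique e f (Joins-ends e) (joins (adjacent e) a∈f b∈f))

    a∉g : ¬ g ∋ a
    a∉g a∈g = e≉g (Joins-unique e g (Joins-ends e) (joins (adjacent e) a∈g b∈g))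

    f≢g : f ≢ g
    f≢g refl = b∉f b∈g

    -- Both are adjacent to `e`, at different ends, and `b` tells them apart.
    f~g : f ~ g
    f~g = cluster c {e} {f} {g} (here refl) (there f∈S) (there g∈S)
      (λ f≈g → b∉f (on-resp {v = b} {g} {f} (≈-sym {f} {g} f≈g) b∈g))
      (e≉f , a , inj₁ refl , a∈f) (e≉g , b , inj₂ refl , b∈g)

    S↭ : ∃[ S′ ] S ↭ f ∷ g ∷ S′
    S↭ with S₁ , S↭f∷S₁ ← ∈⇒∃↭ f∈S
       with S₂ , S₁↭g∷S₂ ← ∈⇒∃↭ (∈-drop S↭f∷S₁ (≢-sym f≢g) g∈S)
       = S₂ , ↭-trans S↭f∷S₁ (↭-prep f S₁↭g∷S₂)

    two-sided : SizeBound (e ∷ S) _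
    -- The common vertex `v` of `f` and `g` is the third corner: it differs from `a` since `g`
    -- avoids `a`, and from `b` since `f` avoids `b`.
    two-sided with S′ , S↭f∷g∷S′ ← S↭ | _ , v , v∈f , v∈g ← f~g =
      SizeBound-resp-↭ (↭-prep e (↭-sym S↭f∷g∷S′)) ↭-refl
        (SizeBound-addTriangle (IsClusterOn-resp-↭ (↭-prep e S↭f∷g∷S′) c) (Joins-ends e)
          (joins (λ { refl → a∉g v∈g }) a∈f v∈f) (joins (λ { refl → b∉f v∈f }) b∈g v∈g)
          (sizeBound S′ (rs (subst (λ k → length S′ < suc k) (sym (↭-length S↭f∷g∷S′))
            (s≤s (ℕ.m≤n+m _ 2))))))

  generalPosition⇒SizeBound : ∀ {S} → IsGeneralPositionSet L S → SizeBound S (allFin n)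
  generalPosition⇒SizeBound {S} gp = sizeBound S (<-wellFounded _) record
    { unique  = IsGeneralPositionSet.unique gp
    ; cluster = λ {x} {y} {z} x∈ y∈ z∈ →
        generalPosition⇒cluster L gp {x} {y} {z} (∈⇒∈ᴸ x∈) (∈⇒∈ᴸ y∈) (∈⇒∈ᴸ z∈)
    ; ends    = λ {_} {v} _ _ → ∈-allFin v
    }
    where
    ∈⇒∈ᴸ : ∀ {x} → x ∈ S → x ∈ᴸ S
    ∈⇒∈ᴸ {x} = Any.map λ { refl → ≈-refl {x} }

  length-allFin : length (allFin n) ≡ n
  length-allFin = length-tabulate id

  generalPosition⇒≤n : ∀ S → IsGeneralPositionSet L S → length S ≤ n
  generalPosition⇒≤n S gp with generalPosition⇒SizeBound gp
  ... | fewer S<n     = subst (length S ≤_) length-allFin (ℕ.<⇒≤ S<n)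
  ... | tight S≡n _ _ = ℕ.≤-reflexive (trans S≡n length-allFin)

  generalPosition⇒≤n∸1 : 3 ∤ n → ∀ S → IsGeneralPositionSet L S → length S ≤ n ∸ 1
  generalPosition⇒≤n∸1 3∤n S gp with generalPosition⇒SizeBound gp
  ... | fewer S<n     = ℕ.<⇒≤pred (subst (length S <_) length-allFin S<n)
  ... | tight _ 3∣n _ = contradiction (subst (3 ∣_) length-allFin 3∣n) 3∤n

  -- General position sets from indexed families of edges.

  -- Distinct nonadjacent edges `ab` and `cd` are disjoint, and the edge `ac` meets both.
  L-diam≤2 : ∀ {e f} → e ≉ f → ¬ e ~ f → ∃[ g ] e ~ g × g ~ f
  L-diam≤2 {e@(edge a b _)} {f@(edge c d _)} e≉f e≁f =
    edge a c a≢c ,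
    ((λ { (inj₁ (_ , refl)) → apart (inj₂ refl) (inj₁ refl)
        ; (inj₂ (a≡c , _)) → a≢c a≡c }) , a , inj₁ refl , inj₁ refl) ,
    ((λ { (inj₁ (a≡c , _)) → a≢c a≡c
        ; (inj₂ (refl , _)) → apart (inj₁ refl) (inj₂ refl) }) , c , inj₂ refl , inj₁ refl)
    where
    apart : ∀ {v} → e ∋ v → ¬ f ∋ v
    apart {v} v∈e v∈f = e≁f (e≉f , v , v∈e , v∈f)
    a≢c : a ≢ c
    a≢c refl = apart (inj₁ refl) (inj₁ refl)

  -- Every member of the list is `≈` to some `ε i` and adjacency respects `≈`, so the cluster
  -- condition need only be checked on indices.
  tabulate-generalPosition : ∀ {m} (ε : Fin m → E) → (∀ {i j} → ε i ≈ ε j → i ≡ j) →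
    (∀ {i j k} → ε j ≉ ε k → ε i ~ ε j → ε i ~ ε k → ε j ~ ε k) →
    IsGeneralPositionSet L (tabulate ε)
  tabulate-generalPosition ε ε-injective cluster =
    cluster⇒generalPosition L (λ {e} {f} → L-diam≤2 {e} {f}) {tabulate ε}
      (Uniqueₛ.tabulate⁺ setoidᴸ ε-injective)
      λ {x} {y} {z} → inClusters {x} {y} {z}
    where
    inClusters : IsClusterSet L (_∈ᴸ tabulate ε)
    inClusters {x} {y} {z} x∈ y∈ z∈ y≉z x~y x~z
      with i , x≈εi ← Membershipₛ.∈-tabulate⁻ setoidᴸ {f = ε} {v = x} x∈
         | j , y≈εj ← Membershipₛ.∈-tabulate⁻ setoidᴸ {f = ε} {v = y} y∈
         | k , z≈εk ← Membershipₛ.∈-tabulate⁻ setoidᴸ {f = ε} {v = z} z∈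
      = resp (ε j) y (ε k) z (≈-sym {y} {ε j} y≈εj) (≈-sym {z} {ε k} z≈εk)
          (cluster {i} {j} {k}
            (λ εj≈εk → y≉z (≈-trans {y} {ε j} {z} y≈εj
              (≈-trans {ε j} {ε k} {z} εj≈εk (≈-sym {z} {ε k} z≈εk))))
            (resp x (ε i) y (ε j) x≈εi y≈εj x~y)
            (resp x (ε i) z (ε k) x≈εi z≈εk x~z))
      where
      resp : ∀ e e′ f f′ → e ≈ e′ → f ≈ f′ → e ~ f → e′ ~ f′
      resp e e′ f f′ e≈e′ f≈f′ e~f =
        proj₁ ~-resp-≈ {e′} {f} {f′} f≈f′ (proj₂ ~-resp-≈ {f} {e} {e′} e≈e′ e~f)

-- The spanning star.

star : ∀ {m} → Fin m → Edge (completeGraph (suc m))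
star i = edge zero (suc i) λ ()

-- All edges meet at `zero`, so they form a single clique.
star-generalPosition : ∀ m →
  IsGeneralPositionSet (lineGraph (completeGraph (suc m))) (tabulate (star {m}))
star-generalPosition m = tabulate-generalPosition star
  (λ { (inj₁ (_ , refl)) → refl ; (inj₂ (() , _)) })
  (λ εj≉εk _ _ → εj≉εk , zero , inj₁ refl , inj₁ refl)

-- Disjoint triangles as the orbits of a fixed-point-free map of order three.

module _ {n : ℕ} (σ : Fin n → Fin n) (σ³ : ∀ x → σ (σ (σ x)) ≡ x) (σ≢ : ∀ x → x ≢ σ x) where

  orbitEdge : Fin n → Edge (completeGraph n)
  orbitEdge x = edge x (σ x) (σ≢ x)

  σ-injective : ∀ {x y} → σ x ≡ σ y → x ≡ y
  σ-injective {x} {y} σx≡σy = trans (sym (σ³ x)) (trans (cong (σ ∘ σ) σx≡σy) (σ³ y))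

  -- Comparing the ends `x`, `σ x` with `y`, `σ y` leaves only the other two sides of the triangle
  -- on `x`, `σ x`, `σ (σ x)`; the case `x ≡ σ y` is inverted by applying `σ` twice.
  orbitEdge-adjacent : ∀ {x y} → orbitEdge x ~ₑ orbitEdge y → y ≡ σ x ⊎ y ≡ σ (σ x)
  orbitEdge-adjacent {x} {y} (x≉y , v , inj₁ refl , inj₁ refl) = contradiction (inj₁ (refl , refl)) x≉y
  orbitEdge-adjacent {x} {y} (x≉y , v , inj₁ refl , inj₂ x≡σy) =
    inj₂ (sym (trans (cong (σ ∘ σ) x≡σy) (σ³ y)))
  orbitEdge-adjacent {x} {y} (x≉y , v , inj₂ refl , inj₁ σx≡y) = inj₁ (sym σx≡y)
  orbitEdge-adjacent {x} {y} (x≉y , v , inj₂ refl , inj₂ σx≡σy) with refl ← σ-injective σx≡σy =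
    contradiction (inj₁ (refl , refl)) x≉y

  triangles-generalPosition : IsGeneralPositionSet (lineGraph (completeGraph n)) (tabulate orbitEdge)
  triangles-generalPosition = tabulate-generalPosition orbitEdge injective cluster
    where
    injective : ∀ {x y} → orbitEdge x ≈ₑ orbitEdge y → x ≡ y
    injective (inj₁ (x≡y , _)) = x≡y
    -- Equality with ends swapped would give `σ (σ y) ≡ y`, and `σ³` would then make `y` a fixed
    -- point.
    injective {x} {y} (inj₂ (x≡σy , σx≡y)) =
      contradiction (trans (sym (σ³ y)) (cong σ (trans (cong σ (sym x≡σy)) σx≡y))) (σ≢ y)

    cluster : ∀ {x y z} → ¬ orbitEdge y ≈ₑ orbitEdge z →
      orbitEdge x ~ₑ orbitEdge y → orbitEdge x ~ₑ orbitEdge z → orbitEdge y ~ₑ orbitEdge z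
    cluster {x} {y} {z} y≉z x~y x~z
      with orbitEdge-adjacent {x} {y} x~y | orbitEdge-adjacent {x} {z} x~z
    ... | inj₁ refl | inj₁ refl = contradiction (inj₁ (refl , refl)) y≉z
    -- The two remaining sides of the triangle share the corner `σ (σ x)`.
    ... | inj₁ refl | inj₂ refl = y≉z , σ (σ x) , inj₂ refl , inj₁ refl
    ... | inj₂ refl | inj₁ refl = y≉z , σ (σ x) , inj₁ refl , inj₂ refl
    ... | inj₂ refl | inj₂ refl = contradiction (inj₁ (refl , refl)) y≉z

-- A map of order three on `3q` vertices.

rotate₃ : Fin 3 → Fin 3
rotate₃ zero             = suc zero
rotate₃ (suc zero)       = suc (suc zero)
rotate₃ (suc (suc zero)) = zero

rotate₃-cubed : ∀ i → rotate₃ (rotate₃ (rotate₃ i)) ≡ i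
rotate₃-cubed zero             = refl
rotate₃-cubed (suc zero)       = refl
rotate₃-cubed (suc (suc zero)) = refl

rotate₃-≢ : ∀ i → i ≢ rotate₃ i
rotate₃-≢ zero ()
rotate₃-≢ (suc zero) ()
rotate₃-≢ (suc (suc zero)) ()

module _ (q : ℕ) where

  -- `remQuot` splits the vertices into `q` blocks of three, and each block is rotated; its orbits
  -- are the corner sets of `q` disjoint triangles.
  rotateBlocks : Fin (q * 3) → Fin (q * 3)
  rotateBlocks x = let i , j = remQuot {q} 3 x in combine i (rotate₃ j)

  rotateBlocks-combine : ∀ i j → rotateBlocks (combine i j) ≡ combine i (rotate₃ j)
  rotateBlocks-combine i j = cong (λ (i , j) → combine i (rotate₃ j)) (Fin.remQuot-combine {q} i j)

  rotateBlocks-cubed : ∀ x → rotateBlocks (rotateBlocks (rotateBlocks x)) ≡ x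
  rotateBlocks-cubed x = begin
    rotateBlocks (rotateBlocks (rotateBlocks x))    ≡⟨ cong rotateBlocks (rotateBlocks-combine i _) ⟩
    rotateBlocks (combine i (rotate₃ (rotate₃ j)))  ≡⟨ rotateBlocks-combine i _ ⟩
    combine i (rotate₃ (rotate₃ (rotate₃ j)))       ≡⟨ cong (combine i) (rotate₃-cubed j) ⟩
    combine i j                                     ≡⟨ Fin.combine-remQuot {q} 3 x ⟩
    x                                               ∎
    where
    open ≡-Reasoning
    i = proj₁ (remQuot {q} 3 x)
    j = proj₂ (remQuot {q} 3 x)

  rotateBlocks-≢ : ∀ x → x ≢ rotateBlocks x
  rotateBlocks-≢ x x≡ = rotate₃-≢ j
    (Fin.combine-injectiveʳ i j i (rotate₃ j) (trans (Fin.combine-remQuot {q} 3 x) x≡))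
    where
    i = proj₁ (remQuot {q} 3 x)
    j = proj₂ (remQuot {q} 3 x)

theorem4p4 : (n : ℕ) → 3 ≤ n →
    (3 ∣ n → IsGpNumber (lineGraph (completeGraph n)) n) ×
    (3 ∤ n → IsGpNumber (lineGraph (completeGraph n)) (n ∸ 1))
theorem4p4 (suc m) _ = divisible , nondivisible
  where
  divisible : 3 ∣ suc m → IsGpNumber (lineGraph (completeGraph (suc m))) (suc m)
  -- Replacing the number of vertices by `q * 3` gives the vertex set on which `rotateBlocks q`
  -- acts.
  divisible (divides q n≡q*3) = subst (λ n → IsGpNumber (lineGraph (completeGraph n)) n) (sym n≡q*3) record
    { attained = _ , triangles-generalPosition (rotateBlocks q) (rotateBlocks-cubed q) (rotateBlocks-≢ q)
               , length-tabulate _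
    ; bounded  = generalPosition⇒≤n
    }

  nondivisible : 3 ∤ suc m → IsGpNumber (lineGraph (completeGraph (suc m))) m
  nondivisible 3∤n = record
    -- The star at `zero` has one edge for each of the other `m` vertices, and `suc m ∸ 1` computes
    -- to `m`.
    { attained = _ , star-generalPosition m , length-tabulate _
    ; bounded  = generalPosition⇒≤n∸1 3∤n
    }
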